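{- For any $n \ge 0$, there exists a $1$-Gray code $\mathbb{Z}_n$ for $\mathcal{Z}_n$ such that $\mathrm{first}(\mathbb{Z}_n)=0(001)^\star$ and $\mathrm{last}(\mathbb{Z}_n)=(001)^\star$.
   Context: A binary word is $1$-decreasing if each of its maximal factors of the form $0^a1^b$ with $a>0$ satisfies $a>b$. $\mathcal{Z}_n$ denotes the set of $1$-decreasing words of length $n$ that start with $0$ (with $\mathcal{Z}_0$ consisting of the empty word). A $1$-Gray code for a set of words is an ordered list of all its words such that any two consecutive words have Hamming distance at most one. $\mathrm{first}(\mathbb{L})$ and $\mathrm{last}(\mathbb{L})$ denote the first and last elements of a list $\mathbb{L}$. For a word $v$, $v^\star$ means $v$ repeated as many times as needed to reach length $n$, trimming extra symbols at the end (e.g. for $n=7$, $(001)^\star=0010010$). -}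

module Defs where

open import Data.Bool using (Bool; true; false)
open import Data.Nat using (ℕ; zero; suc; _+_; _<_; _≤_; _∸_)
open import Data.List using (List; []; _∷_; _++_; replicate; length; take; zipWith)
open import Data.Nat.ListAction using (sum)
open import Data.List.Relation.Unary.All using (All)
open import Data.List.Relation.Unary.Unique.Propositional using (Unique)
open import Data.List.Membership.Propositional using (_∈_)
open import Data.Product using (_×_; ∃; Σ; _,_)
open import Data.Sum using (_⊎_)
open import Relation.Binary.PropositionalEquality using (_≡_)

-- Binary words: false = 0, true = 1.
Word : Set
Word = List Bool

-- The rest of the word after a maximal factor 0^a 1^b:
-- either the word ends, or (b > 0 and) the next letter is 0.
-- (If b = 0, a following 0 would extend the 0-run, so the word must end.)
data ValidRest (b : ℕ) : Word → Set where
  end  : ValidRest b []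
  more : ∀ {w} → 0 < b → ValidRest b (false ∷ w)

data DecBlocks : Word → Set where
  nil : DecBlocks []
  blk : ∀ a b {rest} → 0 < a → b < a → ValidRest b rest → DecBlocks rest →
        DecBlocks (replicate a false ++ replicate b true ++ rest)

-- A word is 1-decreasing: after its (possibly empty) leading run of 1s,
-- every maximal factor 0^a 1^b with a > 0 satisfies a > b.
data OneDecreasing : Word → Set where
  lead : ∀ c {w} → DecBlocks w → OneDecreasing (replicate c true ++ w)

data StartsWith0OrEmpty : Word → Set where
  empty : StartsWith0OrEmpty []
  zero0 : ∀ {w} → StartsWith0OrEmpty (false ∷ w)

InZ : ℕ → Word → Set
InZ n w = length w ≡ n × OneDecreasing w × StartsWith0OrEmpty w

-- Hamming distance (for words of equal length).
diff : Bool → Bool → ℕ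
diff true true = 0
diff false false = 0
diff _ _ = 1

hamming : Word → Word → ℕ
hamming u v = sum (zipWith diff u v)

data Consec1 : List Word → Set where
  []  : Consec1 []
  [_] : ∀ u → Consec1 (u ∷ [])
  _∷_ : ∀ {u v L} → hamming u v ≤ 1 → Consec1 (v ∷ L) → Consec1 (u ∷ v ∷ L)

IsGrayCode1 : (Word → Set) → List Word → Set
IsGrayCode1 P L = Unique L × All P L × (∀ w → P w → w ∈ L) × Consec1 L

-- v^⋆ : v repeated, trimmed to length n  (v assumed nonempty)
star : ℕ → Word → Word
star n v = take n (concatRep n)
  where
  concatRep : ℕ → Word
  concatRep zero = []
  concatRep (suc k) = v ++ concatRep k

First : List Word → Word → Set
First L x = ∃ λ L' → L ≡ x ∷ L'

Last : List Word → Word → Set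
Last L x = ∃ λ L' → L ≡ L' ++ (x ∷ [])

{-# OPTIONS --safe #-}
module Submission where

-- Let s_m = (001)^⋆ and f_m = 0 s_{m-1}. Every word of Z_n other than 0^n is uniquely
-- 0^a 1^b z with a > b ≥ 1 and z in Z_{n-a-b}. Two kinds of bit flips link these cells:
-- 0^{a+1} 1^b z — 0^a 1^{b+1} z, and 0^a 1^b 0z — 0^a 1^{b+1} z; since f_m = 0 s_{m-1}, the
-- second one joins the end f of the cell (a,b) to the end s of the cell (a,b+1).
-- Call D_t the cells with a + b = t. Inductively each cell carries a path from f to s, so the
-- rows b = 1, 2, … of D_t can be run through boustrophedon. For j ≡ 0 mod 4, all the cells
-- with a + b ≥ j, together with 0^n, are visited from 0^{j-1} 1 s to 0^{j-1} f as follows: D_j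
-- downwards, D_{j+1} upwards, then recursively everything from D_{j+4} on, then D_{j+3}
-- downwards but for the ends s of its first two rows, D_{j+2} upwards, and the two words left out.
-- For j = 4 this ends at 000 f, next to 001 f, and the remaining words 001 Z_{n-3} lead to 001 s.

open import Defs
open import Data.Nat using (ℕ; zero; suc; pred; _+_; _≤_; _<_; z≤n; s≤s; s≤s⁻¹)
open import Data.Nat.Properties
open import Data.Bool using (Bool; true; false; not)
open import Data.Empty using (⊥-elim)
open import Data.List using (List; []; _∷_; take; _++_; map; reverse; replicate; length; drop)
open import Data.List using () renaming ([_] to ⟨_⟩)
open import Data.List.Membership.Propositional using (_∈_)
open import Data.List.Membership.Propositional.Properties using (∈-map⁺; ∈-map⁻; ∈-++⁺ˡ; ∈-++⁺ʳ; ∈-++⁻)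
open import Data.List.Properties
  using (++-identityʳ; ++-cancelˡ; ∷-injectiveʳ; length-++; length-replicate; map-++; unfold-reverse)
open import Data.List.Relation.Binary.Permutation.Propositional as ↭
  using (_↭_; ↭-refl; ↭-sym; ↭-trans; ↭-reflexive; ↭⇒↭ₛ)
open import Data.List.Relation.Binary.Permutation.Propositional.Properties
  using (map⁺; ++⁺; ++⁺ˡ; ++⁺ʳ; ∈-resp-↭; ++-comm; ↭-reverse; shifts; ++-commutativeMonoid)
open import Data.List.Relation.Unary.All as All using (tabulate)
open import Data.List.Relation.Unary.Any using (here)
open import Data.List.Relation.Unary.Unique.Propositional using (Unique; []; _∷_)
open import Data.Product using (∃; _×_; _,_)
open import Data.Sum using (inj₁; inj₂)
open import Relation.Binary.PropositionalEquality hiding ([_])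
open import Relation.Nullary using (¬_)
open import Algebra.Solver.CommutativeMonoid (++-commutativeMonoid {A = Word}) using (solve; _⊜_; _⊕_)
import Data.List.Relation.Binary.Permutation.Setoid.Properties (setoid Word) as Permutationₛ
import Data.List.Relation.Unary.Unique.Propositional.Properties as Unique

pattern O = false
pattern I = true

-- Bit flips and paths of words.

data Adj : Word → Word → Set where
  flip : ∀ b w → Adj (b ∷ w) (not b ∷ w)
  keep : ∀ b {u v} → Adj u v → Adj (b ∷ u) (b ∷ v)

Adj-sym : ∀ {u v} → Adj u v → Adj v u
Adj-sym (flip O w) = flip I w
Adj-sym (flip I w) = flip O w
Adj-sym (keep b p) = keep b (Adj-sym p)

-- The endpoint is the parameter and comes before the starting point: Path y x L runs from x to y.
data Path (y : Word) : Word → List Word → Set where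
  end  : Path y y (y ∷ [])
  step : ∀ {x z L} → Adj x z → Path y z L → Path y x (x ∷ L)

infixr 5 _▹[_]_

_▹[_]_ : ∀ {x y u v L M} → Path y x L → Adj y u → Path v u M → Path v x (L ++ M)
end      ▹[ e ] q = step e q
step a p ▹[ e ] q = step a (p ▹[ e ] q)

path-reverse : ∀ {x y L} → Path y x L → Path x y (reverse L)
path-reverse end = end
path-reverse (step {x} {L = L} a p) rewrite unfold-reverse x L =
  path-reverse p ▹[ Adj-sym a ] end

path-map : ∀ {f : Word → Word} → (∀ {u v} → Adj u v → Adj (f u) (f v)) →
           ∀ {x y L} → Path y x L → Path (f y) (f x) (map f L)
path-map f end        = end
path-map f (step a p) = step (f a) (path-map f p)

-- Distinct endpoints ensure that something is left after the first word; this is what lets an end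
-- `s` be withheld from a row.
path-drop : ∀ {x y L} → x ≢ y → Path y x L → ∃ λ z → Path y z (drop 1 L)
path-drop x≢y end        with () ← x≢y refl
path-drop x≢y (step a p) = _ , p

path-head : ∀ {x y L} → Path y x L → L ≡ x ∷ drop 1 L
path-head end        = refl
path-head (step a p) = refl

-- Cells and the flips between them.

block : ℕ → ℕ → Word → Word
block a b z = replicate a O ++ replicate b I ++ z

Adj-++ : ∀ p {u v} → Adj u v → Adj (p ++ u) (p ++ v)
Adj-++ []      e = e
Adj-++ (b ∷ p) e = keep b (Adj-++ p e)

Adj-block : ∀ a b {u v} → Adj u v → Adj (block a b u) (block a b v)
Adj-block a b e = Adj-++ (replicate a O) (Adj-++ (replicate b I) e)

-- The tail stays fixed, so this flip joins neighbouring rows of one diagonal; with `b = 0` it leads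
-- into and out of longer runs of zeros.
raise : ∀ a b z → Adj (block (suc a) b z) (block a (suc b) z)
raise zero    b z = flip O _
raise (suc a) b z = keep O (raise a b z)

extend : ∀ a b z → Adj (block a b (O ∷ z)) (block a (suc b) z)
extend a b z = Adj-++ (replicate a O) (ones b)
  where
  ones : ∀ b → Adj (replicate b I ++ O ∷ z) (I ∷ replicate b I ++ z)
  ones zero    = flip O _
  ones (suc b) = keep I (ones b)

block-O : ∀ a z → block a 0 (O ∷ z) ≡ block (suc a) 0 z
block-O zero    z = refl
block-O (suc a) z = cong (O ∷_) (block-O a z)

block-I : ∀ a b z → block a b (I ∷ z) ≡ block a (suc b) z
block-I a b z = cong (replicate a O ++_) (ones b)
  where
  ones : ∀ b → replicate b I ++ I ∷ z ≡ I ∷ replicate b I ++ z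
  ones zero    = refl
  ones (suc b) = cong (I ∷_) (ones b)

-- Diagonals and boustrophedon paths.

row : ℕ → ℕ → List Word → List Word
row a b = map (block a b)

-- Rows b, …, b + k - 1 of the diagonal a + b constant, the bottom row having a = e.
rect : ℕ → ℕ → ℕ → List Word → List Word
rect e zero    b Q = []
rect e (suc k) b Q = row (k + e) b Q ++ rect e k (suc b) Q

snake : ℕ → ℕ → ℕ → List Word → List Word
snake e zero    b Q = []
snake e (suc k) b Q = row (k + e) b Q ++ snake e k (suc b) (reverse Q)

-- The end at which a snake over suc k rows leaves its last row, having entered the first one at x.
pick : ℕ → Word → Word → Word
pick zero    x y = y
pick (suc k) x y = pick k y x

path-row : ∀ a b {x y Q} → Path y x Q → Path (block a b y) (block a b x) (row a b Q)
path-row a b = path-map (Adj-block a b)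

path-snake : ∀ e k b {x y Q} → Path y x Q →
             Path (block e (k + b) (pick k x y)) (block (k + e) b x) (snake e (suc k) b Q)
path-snake e zero    b {x} {y} {Q} p rewrite ++-identityʳ (row e b Q) = path-row e b p
path-snake e (suc k) b {x} {y} {Q} p =
  path-row (suc k + e) b p ▹[ raise (k + e) b y ]
  subst (λ c → Path (block e c (pick k y x)) (block (k + e) (suc b) y) (snake e (suc k) (suc b) (reverse Q)))
        (+-suc k b) (path-snake e k (suc b) (path-reverse p))

data Even : ℕ → Set where
  zero : Even zero
  2+_  : ∀ {x} → Even x → Even (suc (suc x))

pick-even : ∀ {n} x y → Even n → pick n x y ≡ y
pick-even x y zero   = refl
pick-even x y (2+ e) = pick-even x y e

-- `k` is one less than the number of rows. An odd number of rows is left at the end opposite to the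
-- entry, an even number at the same end.
snake-even : ∀ e {k} b {x y Q} → Even k → Path y x Q →
             Path (block e (k + b) y) (block (k + e) b x) (snake e (suc k) b Q)
snake-even e {k} b {x} {y} {Q} ev p =
  subst (λ z → Path (block e (k + b) z) (block (k + e) b x) (snake e (suc k) b Q))
        (pick-even x y ev) (path-snake e k b p)

snake-odd : ∀ e {k} b {x y Q} → Even k → Path y x Q →
            Path (block e (suc k + b) x) (block (suc k + e) b x) (snake e (suc (suc k)) b Q)
snake-odd e {k} b {x} {y} {Q} ev p =
  subst (λ z → Path (block e (suc k + b) z) (block (suc k + e) b x) (snake e (suc (suc k)) b Q))
        (pick-even y x ev) (path-snake e (suc k) b p)

-- Construction of the tours and the codes.

s : ℕ → Word
s 0 = []
s 1 = O ∷ []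
s 2 = O ∷ O ∷ []
s (suc (suc (suc m))) = O ∷ O ∷ I ∷ s m

f : ℕ → Word
f zero    = []
f (suc m) = O ∷ s m

f≢s : ∀ m → f (3 + m) ≢ s (3 + m)
f≢s 0 ()
f≢s (suc m) ()

-- D_j downwards, then D_{j+1} upwards. Codes run from `f` to `s`, whereas both snakes have to start
-- at `s`, hence the reversals. For even `x`, D_j has an odd number of rows and is left at `f`, next
-- to `s` at the foot of D_{j+1}, whose even number of rows leads back to `s`.
ascent : ℕ → List Word → List Word → List Word
ascent x Q Q′ = snake (3 + x) (1 + x) 1 (reverse Q) ++ reverse (snake (3 + x) (2 + x) 1 (reverse Q′))

-- tour x r visits the cells with a + b ≥ j and 0^n, for j = 4 + 2x, x even and n = j - 1 + r.
-- It exists for r ≥ 3 only; the values at r < 3 are junk.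
tour : ℕ → ℕ → List Word
code : ℕ → List Word

tour x 0 = []
tour x 1 = []
tour x 2 = []
tour x 3 =
  snake (3 + x) (1 + x) 1 (code 2) ++
  ⟨ block (3 + x) (suc x + 1) (O ∷ []) ⟩ ++
  -- A last letter `I` belongs to the run of ones, so this snake zigzags between D_{j+1} without its
  -- bottom row, visited just before, and D_{j+2} without its top row, visited just after.
  reverse (snake (4 + x) (1 + x) 1 ((I ∷ []) ∷ (O ∷ []) ∷ [])) ++
  ⟨ block (suc (x + (4 + x))) 1 [] ⟩ ++
  ⟨ block (2 + (x + (4 + x))) 0 [] ⟩
-- In this and the next two tours the rows of D_{j+3} are single words. Nothing has to be held back:
-- D_{j+2} is descended first, then D_{j+3} is climbed to the prescribed last word.
tour x 4 =
  ascent x (code 3) (code 2) ++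
  ⟨ block (2 + (x + (5 + x))) 0 [] ⟩ ++
  snake (4 + x) (2 + x) 1 (code 1) ++
  reverse (snake (4 + x) (3 + x) 1 (code 0))
tour x 5 =
  ascent x (code 4) (code 3) ++
  ⟨ block (2 + (x + (5 + x))) 1 [] ⟩ ++
  ⟨ block (3 + (x + (5 + x))) 0 [] ⟩ ++
  snake (4 + x) (2 + x) 1 (code 2) ++
  ⟨ block (4 + x) (2 + x + 1) (O ∷ []) ⟩ ++
  -- The same zigzag, now through D_{j+3} and D_{j+4}; with an even number of rows it starts and
  -- ends on `O`.
  reverse (snake (5 + x) (2 + x) 1 ((O ∷ []) ∷ (I ∷ []) ∷ []))
tour x 6 =
  ascent x (code 5) (code 4) ++
  snake (5 + x) (3 + x) 1 (code 1) ++
  reverse (snake (5 + x) (4 + x) 1 (code 0)) ++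
  ⟨ block (4 + (x + (5 + x))) 0 [] ⟩ ++
  snake (4 + x) (2 + x) 1 (code 3) ++
  reverse (snake (4 + x) (3 + x) 1 (code 2))
tour x (suc n₆@(suc n₅@(suc n₄@(suc n₃@(suc (suc (suc r))))))) =
  ascent x (code n₆) (code n₅) ++
  tour (2 + x) n₃ ++
  -- The tour must end at 0^{j+2} 1 s, which lies in this row. It is held back together with its
  -- neighbour in the next row, through which it is reached at the end.
  row (2 + (x + (4 + x))) 1 (reverse (drop 1 (reverse (code n₃)))) ++
  row (1 + (x + (4 + x))) 2 (drop 1 (reverse (code n₃))) ++
  snake (4 + x) (1 + x) 3 (code n₃) ++
  reverse (snake (4 + x) (2 + x) 1 (code n₄)) ++
  ⟨ block (1 + (x + (4 + x))) 2 (s n₃) ⟩ ++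
  ⟨ block (2 + (x + (4 + x))) 1 (s n₃) ⟩

code 0 = ⟨ [] ⟩
code 1 = ⟨ O ∷ [] ⟩
code 2 = ⟨ O ∷ O ∷ [] ⟩
code 3 = (O ∷ O ∷ O ∷ []) ∷ (O ∷ O ∷ I ∷ []) ∷ []
code 4 = (O ∷ O ∷ O ∷ I ∷ []) ∷ (O ∷ O ∷ O ∷ O ∷ []) ∷ (O ∷ O ∷ I ∷ O ∷ []) ∷ []
code 5 = (O ∷ O ∷ O ∷ I ∷ O ∷ []) ∷ (O ∷ O ∷ O ∷ I ∷ I ∷ []) ∷ (O ∷ O ∷ O ∷ O ∷ I ∷ []) ∷
         (O ∷ O ∷ O ∷ O ∷ O ∷ []) ∷ (O ∷ O ∷ I ∷ O ∷ O ∷ []) ∷ []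
code (suc (suc (suc n₃@(suc (suc (suc _)))))) = tour 0 n₃ ++ row 2 1 (code n₃)

-- The tours and codes are paths.

top₁ : ∀ x → x + (4 + x) ≡ suc (x + (3 + x))
top₁ x = +-suc x (3 + x)

top₂ : ∀ x → x + (5 + x) ≡ suc (x + (4 + x))
top₂ x = +-suc x (4 + x)

Adj-subst : ∀ {u u′ v v′} → u ≡ u′ → v ≡ v′ → Adj u v → Adj u′ v′
Adj-subst refl refl e = e

path-subst : ∀ {x x′ y y′ L} → x ≡ x′ → y ≡ y′ → Path y x L → Path y′ x′ L
path-subst refl refl p = p

path-ascent : ∀ x m {Q Q′} → Even x → Path (s (suc m)) (f (suc m)) Q → Path (s m) (f m) Q′ →
              Path (block (suc (x + (3 + x))) 1 (s m)) (block (x + (3 + x)) 1 (s (suc m))) (ascent x Q Q′)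
path-ascent x m ev p q =
  snake-even (3 + x) 1 ev (path-reverse p) ▹[ extend (3 + x) (x + 1) (s m) ]
  path-reverse (snake-odd (3 + x) 1 ev (path-reverse q))

single : ∀ {u v} → u ≡ v → Path v u (u ∷ [])
single refl = end

block-OO : ∀ a z → block a 0 (O ∷ O ∷ z) ≡ block (2 + a) 0 z
block-OO a z = trans (block-O a (O ∷ z)) (cong (O ∷_) (block-O a z))

block-OOO : ∀ a z → block a 0 (O ∷ O ∷ O ∷ z) ≡ block (3 + a) 0 z
block-OOO a z = trans (block-O a (O ∷ O ∷ z)) (cong (O ∷_) (block-OO a z))

-- Since `f n` is 000z for n ≥ 3, the prescribed end 0^{j-1} `f n` is 0^{j+2} z.
shift₃ : ∀ x z → block (2 + (x + (4 + x))) 0 z ≡ block (x + (3 + x)) 0 (O ∷ O ∷ O ∷ z)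
shift₃ x z = sym (trans (block-OOO (x + (3 + x)) z) (cong (λ a → block (2 + a) 0 z) (sym (top₁ x))))

-- Clearing the only 1 before a tail 00z merges the zeros into 0^{j+3} z. If z is 1 followed by some
-- `s`, this is the first word of the tour from D_{j+4} on.
launch : ∀ x z → Adj (block (suc (x + (3 + x))) 1 (O ∷ O ∷ z)) (block (2 + (x + (5 + x))) 0 z)
launch x z = Adj-subst refl
  (trans (block-OO (2 + (x + (3 + x))) z)
         (cong (λ a → block a 0 z) (sym (cong (2 +_) (trans (top₂ x) (cong suc (top₁ x)))))))
  (Adj-sym (raise (suc (x + (3 + x))) 0 (O ∷ O ∷ z)))

lower : ∀ x z → block (2 + (x + (5 + x))) 0 z ≡ block (3 + (x + (4 + x))) 0 z
lower x z = cong (λ a → block (2 + a) 0 z) (top₂ x)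

-- Evenness of `x` fixes the parities of the row counts of D_j, ..., D_{j+3}: odd, even, even, odd.
-- The recursive tour adds 2 to `x` and so keeps them.
path-tour : ∀ x n → 3 ≤ n → Even x →
            Path (block (x + (3 + x)) 0 (f n)) (block (x + (3 + x)) 1 (s (pred n))) (tour x n)
path-code : ∀ n → Path (s n) (f n) (code n)

path-code 0 = end
path-code 1 = end
path-code 2 = end
path-code 3 = step (keep O (keep O (flip O _))) end
path-code 4 = step (keep O (keep O (keep O (flip I _)))) (step (keep O (keep O (flip O _))) end)
path-code 5 = step (keep O (keep O (keep O (keep I (flip O _)))))
             (step (keep O (keep O (keep O (flip I _))))
             (step (keep O (keep O (keep O (keep O (flip I _)))))
             (step (keep O (keep O (flip O _))) end)))
path-code (suc (suc (suc n₃@(suc (suc (suc _)))))) =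
  path-tour 0 n₃ (s≤s (s≤s (s≤s z≤n))) zero ▹[ keep O (keep O (flip O _)) ] path-row 2 1 (path-code n₃)

path-tour x 1 (s≤s ())
path-tour x 2 (s≤s (s≤s ()))
path-tour x 3 _ ev =
  snake-even (3 + x) 1 ev (path-code 2) ▹[ extend (3 + x) (x + 1) _ ]
  end ▹[ Adj-sym (raise (3 + x) (x + 1) _) ]
  path-reverse (snake-even (4 + x) 1 ev (step (flip I []) end)) ▹[ Adj-sym (raise (x + (4 + x)) 1 []) ]
  end ▹[ Adj-sym (raise (suc (x + (4 + x))) 0 []) ]
  single (shift₃ x [])
path-tour x 4 _ ev =
  path-ascent x 2 ev (path-code 3) (path-code 2) ▹[ launch x [] ]
  end ▹[ Adj-subst (sym (trans (lower x []) (sym (block-O (2 + (x + (4 + x))) [])))) refl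
                   (raise (suc (x + (4 + x))) 0 _) ]
  snake-odd (4 + x) 1 ev (path-code 1) ▹[ extend (4 + x) (suc x + 1) [] ]
  path-subst refl (shift₃ x _) (path-reverse (snake-even (4 + x) 1 (2+ ev) (path-code 0)))
path-tour x 5 _ ev =
  path-ascent x 3 ev (path-code 4) (path-code 3) ▹[ launch x _ ]
  end ▹[ Adj-sym (raise (2 + (x + (5 + x))) 0 _) ]
  end ▹[ Adj-subst (sym (trans (cong (O ∷_) (lower x [])) (sym (block-OO (2 + (x + (4 + x))) [])))) refl
                   (raise (suc (x + (4 + x))) 0 _) ]
  snake-odd (4 + x) 1 ev (path-code 2) ▹[ extend (4 + x) (suc x + 1) _ ]
  end ▹[ Adj-sym (raise (4 + x) (suc x + 1) _) ]
  path-subst refl (trans (cong (λ a → block (suc a) 1 (O ∷ [])) (top₂ x)) (shift₃ x _))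
    (path-reverse (snake-odd (5 + x) 1 ev (step (flip O []) end)))
path-tour x 6 _ ev =
  path-ascent x 4 ev (path-code 5) (path-code 4) ▹[ launch x _ ]
  snake-even (5 + x) 1 (2+ ev) (path-code 1) ▹[ extend (5 + x) (2 + x + 1) _ ]
  path-reverse (snake-odd (5 + x) 1 (2+ ev) (path-code 0)) ▹[ Adj-sym (raise (3 + (x + (5 + x))) 0 []) ]
  end ▹[ Adj-subst (sym (trans (cong (λ w → O ∷ O ∷ w) (lower x [])) (sym (block-OOO (2 + (x + (4 + x))) []))))
                   refl (raise (suc (x + (4 + x))) 0 _) ]
  snake-odd (4 + x) 1 ev (path-code 3) ▹[ extend (4 + x) (suc x + 1) _ ]
  path-subst refl (shift₃ x _) (path-reverse (snake-even (4 + x) 1 (2+ ev) (path-code 2)))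
path-tour x (suc n₆@(suc n₅@(suc n₄@(suc n₃@(suc (suc (suc r))))))) _ ev =
  -- `w` is the neighbour of `s n₃` in the code; both shortened rows have the ends `w` and `f n₃`.
  let w , p = path-drop (λ e → f≢s r (sym e)) (path-reverse (path-code n₃)) in
  path-ascent x n₅ ev (path-code n₆) (path-code n₅) ▹[ launch x _ ]
  path-tour (2 + x) n₃ (s≤s (s≤s (s≤s z≤n))) (2+ ev)
    ▹[ Adj-subst (sym (lower x (f n₃))) refl (raise (2 + (x + (4 + x))) 0 (f n₃)) ]
  path-row (2 + (x + (4 + x))) 1 (path-reverse p) ▹[ raise (1 + (x + (4 + x))) 1 w ]
  path-row (1 + (x + (4 + x))) 2 p ▹[ raise (x + (4 + x)) 2 (f n₃) ]
  snake-even (4 + x) 3 ev (path-code n₃)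
    -- As `f n₄` is 0 followed by `s n₃`, the link `extend`, read backwards, leads from the foot of
    -- D_{j+3} to that of D_{j+2}.
    ▹[ Adj-subst (cong (λ b → block (4 + x) b (s n₃)) (sym (trans (+-suc x 2) (cong suc (+-suc x 1))))) refl
                 (Adj-sym (extend (4 + x) (suc x + 1) (s n₃))) ]
  path-reverse (snake-odd (4 + x) 1 ev (path-code n₄)) ▹[ extend (1 + (x + (4 + x))) 1 _ ]
  end ▹[ Adj-sym (raise (1 + (x + (4 + x))) 1 _) ]
  single (shift₃ x _)

-- The words of a tour, up to order.

-- The cells with a + b ≥ t, diagonal by diagonal, then 0^{t-1+n}; here t = 2 + 2k for cellsₑ
-- and t = 1 + 2k for cellsₒ. Every tour is a rearrangement of such a list.
cellsₑ cellsₒ : ℕ → ℕ → List Word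
cellsₑ k zero    = ⟨ block (suc (k + k)) 0 [] ⟩
cellsₑ k (suc n) = rect (2 + k) k 1 (code n) ++ cellsₒ (suc k) n
cellsₒ k zero    = ⟨ block (k + k) 0 [] ⟩
cellsₒ k (suc n) = rect (1 + k) k 1 (code n) ++ cellsₑ k n

snake-↭ : ∀ e k b {Q R} → Q ↭ R → snake e k b Q ↭ rect e k b R
snake-↭ e zero    b p = ↭-refl
snake-↭ e (suc k) b {Q} p =
  ++⁺ (map⁺ (block (k + e) b) p) (snake-↭ e k (suc b) (↭-trans (↭-reverse Q) p))

rect-↭ : ∀ e k b {Q R} → Q ↭ R → rect e k b Q ↭ rect e k b R
rect-↭ e zero    b p = ↭-refl
rect-↭ e (suc k) b p = ++⁺ (map⁺ (block (k + e) b) p) (rect-↭ e k (suc b) p)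

reverse-snake-↭ : ∀ e k b {Q R} → Q ↭ R → reverse (snake e k b Q) ↭ rect e k b R
reverse-snake-↭ e k b p = ↭-trans (↭-reverse _) (snake-↭ e k b p)

rect-++ : ∀ e k b Q R → rect e k b (Q ++ R) ↭ rect e k b Q ++ rect e k b R
rect-++ e zero    b Q R = ↭-refl
rect-++ e (suc k) b Q R = ↭-trans
  (++⁺ (↭-reflexive (map-++ (block (k + e) b) Q R)) (rect-++ e k (suc b) Q R))
  (solve 4 (λ q r q′ r′ → (q ⊕ r) ⊕ (q′ ⊕ r′) ⊜ (q ⊕ q′) ⊕ (r ⊕ r′)) ↭-refl
    (row (k + e) b Q) (row (k + e) b R) (rect e k (suc b) Q) (rect e k (suc b) R))

-- Untangles the zigzags of the short tours: moving the 1 from the tail into the block leads to the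
-- next diagonal.
rect-I : ∀ e k b z → rect e k b ⟨ I ∷ z ⟩ ≡ rect e k (suc b) ⟨ z ⟩
rect-I e zero    b z = refl
rect-I e (suc k) b z = cong₂ _∷_ (block-I (k + e) b z) (rect-I e k (suc b) z)

-- `rect` unfolds from its top row, but the zigzagging tours visit the bottom row of a diagonal
-- separately.
rect-bottom : ∀ e k b Q → rect e (suc k) b Q ↭ row e (k + b) Q ++ rect (suc e) k b Q
rect-bottom e zero    b Q = ↭-refl
rect-bottom e (suc k) b Q rewrite +-suc k e = ↭-trans
  (++⁺ˡ (row (suc k + e) b Q) (rect-bottom e k (suc b) Q))
  (↭-trans (shifts (row (suc k + e) b Q) (row e (k + suc b) Q))
    (++⁺ (↭-reflexive (cong (λ c → row e c Q) (+-suc k b))) ↭-refl))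

ascent-↭ : ∀ x Q Q′ → ascent x Q Q′ ↭ rect (3 + x) (1 + x) 1 Q ++ rect (3 + x) (2 + x) 1 Q′
ascent-↭ x Q Q′ =
  ++⁺ (snake-↭ (3 + x) (1 + x) 1 (↭-reverse Q)) (reverse-snake-↭ (3 + x) (2 + x) 1 (↭-reverse Q′))

zeros-≡ : ∀ {a b} → a ≡ b → ⟨ block a 0 [] ⟩ ↭ ⟨ block b 0 [] ⟩
zeros-≡ a≡b = ↭-reflexive (cong (λ a → ⟨ block a 0 [] ⟩) a≡b)

tour-↭ : ∀ x n → 3 ≤ n → tour x n ↭ cellsₑ (1 + x) n
tour-↭ x 1 (s≤s ())
tour-↭ x 2 (s≤s (s≤s ()))
tour-↭ x 3 _ = ↭-trans
  (++⁺ (snake-↭ (3 + x) (1 + x) 1 {code 2} ↭-refl)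
  (++⁺ˡ ⟨ block (3 + x) (suc x + 1) (O ∷ []) ⟩
  (++⁺ (↭-trans (reverse-snake-↭ (4 + x) (1 + x) 1 {(I ∷ []) ∷ (O ∷ []) ∷ []} ↭-refl)
       (↭-trans (rect-++ (4 + x) (1 + x) 1 ⟨ I ∷ [] ⟩ ⟨ O ∷ [] ⟩)
                (++⁺ (↭-reflexive (rect-I (4 + x) (1 + x) 1 [])) ↭-refl)))
  (++⁺ˡ ⟨ block (suc (x + (4 + x))) 1 [] ⟩ (zeros-≡ (cong (2 +_) (top₁ x)))))))
  (↭-trans
  (solve 6 (λ a y p q w o → a ⊕ y ⊕ (p ⊕ q) ⊕ w ⊕ o ⊜ a ⊕ (y ⊕ q) ⊕ (w ⊕ p) ⊕ o) ↭-refl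
    (rect (3 + x) (1 + x) 1 (code 2)) ⟨ block (3 + x) (suc x + 1) (O ∷ []) ⟩
    (rect (4 + x) (1 + x) 2 (code 0)) (rect (4 + x) (1 + x) 1 (code 1))
    ⟨ block (suc (x + (4 + x))) 1 [] ⟩ (cellsₒ (3 + x) 0))
  (++⁺ˡ (rect (3 + x) (1 + x) 1 (code 2)) (++⁺ (↭-sym (rect-bottom (3 + x) (1 + x) 1 (code 1))) ↭-refl)))
tour-↭ x 4 _ = ↭-trans
  (++⁺ (ascent-↭ x (code 3) (code 2))
  (++⁺ (zeros-≡ (cong (2 +_) (trans (top₂ x) (cong suc (top₁ x)))))
  (++⁺ (snake-↭ (4 + x) (2 + x) 1 {code 1} ↭-refl)
       (reverse-snake-↭ (4 + x) (3 + x) 1 {code 0} ↭-refl))))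
  (solve 5 (λ a b o c d → (a ⊕ b) ⊕ o ⊕ c ⊕ d ⊜ a ⊕ b ⊕ c ⊕ d ⊕ o) ↭-refl
    (rect (3 + x) (1 + x) 1 (code 3)) (rect (3 + x) (2 + x) 1 (code 2)) _
    (rect (4 + x) (2 + x) 1 (code 1)) (rect (4 + x) (3 + x) 1 (code 0)))
tour-↭ x 5 _ = ↭-trans
  (++⁺ (ascent-↭ x (code 4) (code 3))
  (++⁺ˡ ⟨ block (2 + (x + (5 + x))) 1 [] ⟩
  (++⁺ (zeros-≡ (cong (3 +_) (top₂ x)))
  (++⁺ (snake-↭ (4 + x) (2 + x) 1 {code 2} ↭-refl)
  (++⁺ˡ ⟨ block (4 + x) (2 + x + 1) (O ∷ []) ⟩
       (↭-trans (reverse-snake-↭ (5 + x) (2 + x) 1 {(O ∷ []) ∷ (I ∷ []) ∷ []} ↭-refl)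
       (↭-trans (rect-++ (5 + x) (2 + x) 1 ⟨ O ∷ [] ⟩ ⟨ I ∷ [] ⟩)
                (++⁺ˡ (rect (5 + x) (2 + x) 1 (code 1)) (↭-reflexive (rect-I (5 + x) (2 + x) 1 []))))))))))
  (↭-trans
  (solve 8 (λ a b w o c y p q → (a ⊕ b) ⊕ w ⊕ o ⊕ c ⊕ y ⊕ (p ⊕ q) ⊜ (a ⊕ b ⊕ c) ⊕ (y ⊕ p) ⊕ (w ⊕ q) ⊕ o) ↭-refl
    (rect (3 + x) (1 + x) 1 (code 4)) (rect (3 + x) (2 + x) 1 (code 3))
    ⟨ block (2 + (x + (5 + x))) 1 [] ⟩ (cellsₒ (4 + x) 0)
    (rect (4 + x) (2 + x) 1 (code 2)) ⟨ block (4 + x) (2 + x + 1) (O ∷ []) ⟩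
    (rect (5 + x) (2 + x) 1 (code 1)) (rect (5 + x) (2 + x) 2 (code 0)))
  (↭-trans
    (++⁺ˡ (rect (3 + x) (1 + x) 1 (code 4) ++ rect (3 + x) (2 + x) 1 (code 3) ++
           rect (4 + x) (2 + x) 1 (code 2))
    (++⁺ʳ (cellsₑ (3 + x) 1) (↭-sym (rect-bottom (4 + x) (2 + x) 1 (code 1)))))
    (solve 4 (λ a b c d → (a ⊕ b ⊕ c) ⊕ d ⊜ a ⊕ b ⊕ c ⊕ d) ↭-refl
      (rect (3 + x) (1 + x) 1 (code 4)) (rect (3 + x) (2 + x) 1 (code 3)) (rect (4 + x) (2 + x) 1 (code 2))
      (rect (4 + x) (3 + x) 1 (code 1) ++ cellsₑ (3 + x) 1))))
tour-↭ x 6 _ = ↭-trans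
  (++⁺ (ascent-↭ x (code 5) (code 4))
  (++⁺ (snake-↭ (5 + x) (3 + x) 1 {code 1} ↭-refl)
  (++⁺ (reverse-snake-↭ (5 + x) (4 + x) 1 {code 0} ↭-refl)
  (++⁺ (zeros-≡ (cong (4 +_) (top₂ x)))
  (++⁺ (snake-↭ (4 + x) (2 + x) 1 {code 3} ↭-refl)
       (reverse-snake-↭ (4 + x) (3 + x) 1 {code 2} ↭-refl))))))
  (solve 7 (λ a b w v o c d → (a ⊕ b) ⊕ w ⊕ v ⊕ o ⊕ c ⊕ d ⊜ a ⊕ b ⊕ c ⊕ d ⊕ w ⊕ v ⊕ o) ↭-refl
    (rect (3 + x) (1 + x) 1 (code 5)) (rect (3 + x) (2 + x) 1 (code 4))
    (rect (5 + x) (3 + x) 1 (code 1)) (rect (5 + x) (4 + x) 1 (code 0)) _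
    (rect (4 + x) (2 + x) 1 (code 3)) (rect (4 + x) (3 + x) 1 (code 2)))
tour-↭ x (suc n₆@(suc n₅@(suc n₄@(suc n₃@(suc (suc (suc r))))))) _ = ↭-trans
  (++⁺ (ascent-↭ x (code n₆) (code n₅))
  (++⁺ (tour-↭ (2 + x) n₃ (s≤s (s≤s (s≤s z≤n))))
  (++⁺ (map⁺ _ (↭-reverse T))
  (++⁺ ↭-refl
  (++⁺ (snake-↭ (4 + x) (1 + x) 3 Q↭)
  (++⁺ (reverse-snake-↭ (4 + x) (2 + x) 1 {code n₄} ↭-refl)
       ↭-refl))))))
  (↭-trans
  -- The held-back words `v` and `u` rejoin their rows `p` and `q`; with `c` these make up D_{j+3}.
  (solve 9 (λ a b t p q c d u v →
      (a ⊕ b) ⊕ t ⊕ p ⊕ q ⊕ c ⊕ d ⊕ u ⊕ v ⊜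
      (a ⊕ b ⊕ d) ⊕ ((v ⊕ p) ⊕ (u ⊕ q) ⊕ c) ⊕ t) ↭-refl
    (rect (3 + x) (1 + x) 1 (code n₆)) (rect (3 + x) (2 + x) 1 (code n₅))
    (cellsₑ (3 + x) n₃) (row (2 + (x + (4 + x))) 1 T) (row (1 + (x + (4 + x))) 2 T) (rect (4 + x) (1 + x) 3 (s n₃ ∷ T))
    (rect (4 + x) (2 + x) 1 (code n₄)) ⟨ _ ⟩ ⟨ _ ⟩)
  (↭-trans
    (++⁺ˡ (rect (3 + x) (1 + x) 1 (code n₆) ++ rect (3 + x) (2 + x) 1 (code n₅) ++
           rect (4 + x) (2 + x) 1 (code n₄))
    (++⁺ (↭-sym (rect-↭ (4 + x) (3 + x) 1 Q↭)) ↭-refl))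
    (solve 5 (λ a b c d t → (a ⊕ b ⊕ c) ⊕ d ⊕ t ⊜ a ⊕ b ⊕ c ⊕ d ⊕ t) ↭-refl
      (rect (3 + x) (1 + x) 1 (code n₆)) (rect (3 + x) (2 + x) 1 (code n₅)) (rect (4 + x) (2 + x) 1 (code n₄))
      (rect (4 + x) (3 + x) 1 (code n₃)) (cellsₑ (3 + x) n₃))))
  where
  T : List Word
  T = drop 1 (reverse (code n₃))
  Q↭ : code n₃ ↭ s n₃ ∷ T
  -- That the dropped word is `s n₃` follows from the endpoint of the path.
  Q↭ = ↭-trans (↭-sym (↭-reverse (code n₃))) (↭-reflexive (path-head (path-reverse (path-code n₃))))

-- The diagonals 1 and 2 contain no cell with a > b ≥ 1, and diagonal 3 only the cell (2,1), which
-- is the final row of `code`.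
code-↭ : ∀ n → code n ↭ cellsₒ 0 n
code-↭ 0 = ↭-refl
code-↭ 1 = ↭-refl
code-↭ 2 = ↭-refl
code-↭ 3 = ↭.swap _ _ ↭-refl
code-↭ 4 = ++-comm (_ ∷ _ ∷ []) ⟨ _ ⟩
code-↭ 5 = ↭-trans (++-comm (_ ∷ _ ∷ _ ∷ _ ∷ []) ⟨ _ ⟩) (↭.prep _ (↭.prep _ (↭.swap _ _ ↭-refl)))
code-↭ (suc (suc (suc n₃@(suc (suc (suc _)))))) = ↭-trans
  (++⁺ (tour-↭ 0 n₃ (s≤s (s≤s (s≤s z≤n)))) ↭-refl)
  (↭-trans (++-comm (cellsₑ 1 n₃) (row 2 1 (code n₃)))
    (++⁺ (↭-reflexive (sym (++-identityʳ (row 2 1 (code n₃))))) ↭-refl))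

-- Uniqueness of the block decomposition.

ones-injective : ∀ b b′ {z z′} → StartsWith0OrEmpty z → StartsWith0OrEmpty z′ →
                 replicate b I ++ z ≡ replicate b′ I ++ z′ → b ≡ b′
ones-injective zero    zero     st st′ eq = refl
ones-injective zero    (suc b′) empty st′ ()
ones-injective zero    (suc b′) zero0 st′ ()
ones-injective (suc b) zero     st empty ()
ones-injective (suc b) zero     st zero0 ()
ones-injective (suc b) (suc b′) st st′ eq = cong suc (ones-injective b b′ st st′ (∷-injectiveʳ eq))

-- A tail that does not start with 1 cannot lengthen the run of ones, so both runs can be read off
-- from the word.
block-injective : ∀ a b a′ b′ {z z′} → StartsWith0OrEmpty z → StartsWith0OrEmpty z′ →
                  block a (suc b) z ≡ block a′ (suc b′) z′ → a ≡ a′ × b ≡ b′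
block-injective zero    b zero     b′ st st′ eq = refl , ones-injective b b′ st st′ (∷-injectiveʳ eq)
block-injective zero    b (suc a′) b′ st st′ ()
block-injective (suc a) b zero     b′ st st′ ()
block-injective (suc a) b (suc a′) b′ st st′ eq with block-injective a b a′ b′ st st′ (∷-injectiveʳ eq)
... | refl , refl = refl , refl

block≢zeros : ∀ a b z n → block a (suc b) z ≢ block n 0 []
block≢zeros zero    b z zero    ()
block≢zeros zero    b z (suc n) ()
block≢zeros (suc a) b z zero    ()
block≢zeros (suc a) b z (suc n) eq = block≢zeros a b z n (∷-injectiveʳ eq)

∈-rect⁻ : ∀ e k b {Q w} → w ∈ rect e k b Q → ∃ λ a → ∃ λ c → ∃ λ z →
          w ≡ block a c z × z ∈ Q × b ≤ c × c < k + b × e ≤ a × suc (a + c) ≡ k + e + b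
∈-rect⁻ e (suc k) b {Q} w∈ with ∈-++⁻ (row (k + e) b Q) w∈
... | inj₁ w∈row with z , z∈ , refl ← ∈-map⁻ (block (k + e) b) w∈row =
  k + e , b , z , refl , z∈ , ≤-refl , s≤s (m≤n+m b k) , m≤n+m e k , refl
... | inj₂ w∈rest with a , c , z , eq , z∈ , b<c , c< , e≤a , sum ← ∈-rect⁻ e k (suc b) w∈rest =
  a , c , z , eq , z∈ , <⇒≤ b<c , subst (c <_) (+-suc k b) c< , e≤a , trans sum (+-suc (k + e) b)

∈-rect⁺ : ∀ e b i j {z Q} → z ∈ Q → block (i + e) (j + b) z ∈ rect e (suc (j + i)) b Q
∈-rect⁺ e b i zero    z∈ = ∈-++⁺ˡ (∈-map⁺ (block (i + e) b) z∈)
∈-rect⁺ e b i (suc j) {z} {Q} z∈ = ∈-++⁺ʳ (row (suc (j + i) + e) b Q)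
  (subst (λ c → block (i + e) c z ∈ rect e (suc (j + i)) (suc b) Q) (+-suc j b) (∈-rect⁺ e (suc b) i j z∈))

rect-unique : ∀ e k b {Q} → Unique Q → (∀ {z} → z ∈ Q → StartsWith0OrEmpty z) →
              Unique (rect e k (suc b) Q)
rect-unique e zero    b u st = []
rect-unique e (suc k) b {Q} u st =
  Unique.++⁺ (Unique.map⁺ (λ eq → ++-cancelˡ (replicate (suc b) I) _ _ (++-cancelˡ (replicate (k + e) O) _ _ eq)) u)
             (rect-unique e k (suc b) u st) disjoint
  where
  disjoint : ∀ {w} → ¬ (w ∈ row (k + e) (suc b) Q × w ∈ rect e k (suc (suc b)) Q)
  disjoint (p , q) with ∈-map⁻ (block (k + e) (suc b)) p | ∈-rect⁻ e k (suc (suc b)) q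
  ... | y , y∈ , refl | a , suc c , z , eq , z∈ , s≤s b<c , _ with block-injective (k + e) b a c (st y∈) (st z∈) eq
  ... | _ , refl = <-irrefl refl b<c

-- Enumeration of the words diagonal by diagonal.

data Tail (t n : ℕ) : Word → Set where
  zeros : Tail t n (block n 0 [])
  cell  : ∀ a b {m z} → suc b < a → t ≤ a + suc b → a + suc b + m ≡ n → InZ m z →
          Tail t n (block a (suc b) z)

Enumerates : (Word → Set) → List Word → Set
Enumerates P L = Unique L × (∀ {w} → w ∈ L → P w) × (∀ {w} → P w → w ∈ L)

enumerates-base : ∀ n → Enumerates (Tail (suc n) n) ⟨ block n 0 [] ⟩
enumerates-base n = All.[] ∷ [] , sound , complete
  where
  sound : ∀ {w} → w ∈ ⟨ block n 0 [] ⟩ → Tail (suc n) n w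
  sound (here refl) = zeros
  complete : ∀ {w} → Tail (suc n) n w → w ∈ ⟨ block n 0 [] ⟩
  complete zeros = here refl
  complete (cell a b _ n<t eq _) =
    ⊥-elim (<-irrefl refl (≤-trans n<t (≤-trans (m≤m+n (a + suc b) _) (≤-reflexive eq))))

-- The bounds leave `e = k + 1` and `e = k + 2`, for which the `k` rows are exactly the cells with a
-- > b ≥ 1 on the diagonal `t`.
enumerates-step : ∀ {t n m k e Q L} → k < e → e ≤ 2 + k → k + e ≡ t → t + m ≡ n →
                  Enumerates (InZ m) Q → Enumerates (Tail (suc t) n) L →
                  Enumerates (Tail t n) (rect e k 1 Q ++ L)
enumerates-step {t} {n} {m} {k} {e} {Q} {L} k<e e≤2+k k+e≡t t+m≡n (uQ , soundQ , completeQ) (uL , soundL , completeL) =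
  Unique.++⁺ (rect-unique e k 0 uQ (λ z∈ → starts (soundQ z∈))) uL disjoint , sound , complete
  where
  starts : ∀ {m z} → InZ m z → StartsWith0OrEmpty z
  starts (_ , _ , st) = st

  diagonal : ∀ a c → suc (a + c) ≡ k + e + 1 → a + c ≡ t
  diagonal a c eq = trans (suc-injective (trans eq (+-comm (k + e) 1))) k+e≡t

  disjoint : ∀ {w} → ¬ (w ∈ rect e k 1 Q × w ∈ L)
  disjoint (p , q) with ∈-rect⁻ e k 1 p
  ... | a , suc c , z , refl , z∈ , s≤s _ , _ , _ , sum = contra refl (soundL q)
    where
    contra : ∀ {w} → w ≡ block a (suc c) z → ¬ Tail (suc t) n w
    contra eq zeros = block≢zeros a c z n (sym eq)
    contra eq (cell a′ b′ _ t< _ z′∈) with block-injective a c a′ b′ (starts (soundQ z∈)) (starts z′∈) (sym eq)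
    ... | refl , refl = <-irrefl (sym (diagonal a (suc c) sum)) t<

  sound : ∀ {w} → w ∈ rect e k 1 Q ++ L → Tail t n w
  sound w∈ with ∈-++⁻ (rect e k 1 Q) w∈
  ... | inj₁ p with ∈-rect⁻ e k 1 p
  ... | a , suc c , z , refl , z∈ , s≤s _ , c<k+1 , e≤a , sum =
    cell a c (≤-trans (≤-trans c<k+1 (≤-trans (≤-reflexive (+-comm k 1)) k<e)) e≤a)
         (≤-reflexive (sym (diagonal a (suc c) sum))) (trans (cong (_+ m) (diagonal a (suc c) sum)) t+m≡n) (soundQ z∈)
  sound w∈ | inj₂ q with soundL q
  ... | zeros = zeros
  ... | cell a b b<a t< eq z∈ = cell a b b<a (<⇒≤ t<) eq z∈

  complete : ∀ {w} → Tail t n w → w ∈ rect e k 1 Q ++ L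
  complete zeros = ∈-++⁺ʳ (rect e k 1 Q) (completeL zeros)
  complete (cell a b {m′} {z} b<a t≤ eq z∈) with m≤n⇒m<n∨m≡n t≤
  ... | inj₁ t<  = ∈-++⁺ʳ (rect e k 1 Q) (completeL (cell a b b<a t< eq z∈))
  ... | inj₂ t≡ with m≤n⇒∃[o]m+o≡n e≤a
    where
    e≤a : e ≤ a
    -- Otherwise a ≤ k + 1, so there are at most `k` ones and the cell lies below the diagonal `t`.
    e≤a = ≮⇒≥ λ a<e → <-irrefl (trans (sym t≡) (trans (sym k+e≡t) (+-comm k e)))
      (+-mono-<-≤ a<e (s≤s⁻¹ (≤-trans b<a (s≤s⁻¹ (≤-trans a<e e≤2+k)))))
  ... | i , e+i≡a = ∈-++⁺ˡ (subst₂ (λ a k → block a (suc b) z ∈ rect e k 1 Q) (trans (+-comm i e) e+i≡a) k≡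
                      (subst (λ c → block (i + e) c z ∈ rect e (suc (b + i)) 1 Q) (+-comm b 1)
                        (∈-rect⁺ e 1 i b (completeQ (subst (λ m → InZ m z) m′≡m z∈)))))
    where
    k≡ : suc (b + i) ≡ k
    k≡ = +-cancelˡ-≡ e _ _ (begin
      e + suc (b + i)   ≡⟨ cong (e +_) (cong suc (+-comm b i)) ⟩
      e + suc (i + b)   ≡⟨ cong (e +_) (+-suc i b) ⟨
      e + (i + suc b)   ≡⟨ +-assoc e i (suc b) ⟨
      e + i + suc b     ≡⟨ cong (_+ suc b) e+i≡a ⟩
      a + suc b         ≡⟨ t≡ ⟨
      t                 ≡⟨ k+e≡t ⟨
      k + e             ≡⟨ +-comm k e ⟩
      e + k             ∎)
      where open ≡-Reasoning
    m′≡m : m′ ≡ m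
    m′≡m = +-cancelˡ-≡ t _ _ (trans (cong (_+ m′) t≡) (trans eq (sym t+m≡n)))

length-block : ∀ a b z → length (block a b z) ≡ a + b + length z
length-block a b z = begin
  length (block a b z)
    ≡⟨ length-++ (replicate a O) ⟩
  length (replicate a O) + length (replicate b I ++ z)
    ≡⟨ cong₂ _+_ (length-replicate a) (length-++ (replicate b I)) ⟩
  a + (length (replicate b I) + length z)
    ≡⟨ cong (λ l → a + (l + length z)) (length-replicate b) ⟩
  a + (b + length z)
    ≡⟨ +-assoc a b (length z) ⟨
  a + b + length z ∎
  where open ≡-Reasoning

length-zeros : ∀ n → length (block n 0 []) ≡ n
length-zeros n = trans (length-block n 0 []) (trans (+-identityʳ (n + 0)) (+-identityʳ n))

InZ⇒Tail : ∀ {n w} → InZ n w → Tail 1 n w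
InZ⇒Tail (refl , lead zero nil , _) = zeros
InZ⇒Tail (refl , lead zero (blk a zero _ _ end _) , _) =
  subst (λ n → Tail 1 n (block a 0 [])) (sym (length-zeros a)) zeros
InZ⇒Tail (refl , lead zero (blk a (suc b) {rest} 0<a b<a v d) , _) =
  cell a b b<a (≤-trans (s≤s z≤n) (m≤n+m (suc b) a)) (sym (length-block a (suc b) rest)) (refl , lead 0 d , start v)
  where
  start : ∀ {b w} → ValidRest b w → StartsWith0OrEmpty w
  start end      = empty
  start (more _) = zero0

Tail⇒InZ : ∀ {n w} → Tail 1 n w → InZ n w
Tail⇒InZ {zero}  zeros = refl , lead 0 nil , empty
Tail⇒InZ {suc n} zeros = length-zeros (suc n) , lead 0 (blk (suc n) 0 (s≤s z≤n) (s≤s z≤n) end nil) , zero0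
Tail⇒InZ (cell (suc a) b {z = z} (s≤s b<a) _ refl (refl , lead zero d , st)) =
  length-block (suc a) (suc b) z , lead 0 (blk (suc a) (suc b) (s≤s z≤n) (s≤s b<a) (rest st) d) , zero0
  where
  rest : ∀ {z} → StartsWith0OrEmpty z → ValidRest (suc b) z
  rest empty = end
  rest zero0 = more (s≤s z≤n)

enumerates-↭ : ∀ {P L M} → L ↭ M → Enumerates P M → Enumerates P L
enumerates-↭ L↭M (u , sound , complete) =
  Permutationₛ.Unique-resp-↭ (↭⇒↭ₛ (↭-sym L↭M)) u ,
  (λ w∈ → sound (∈-resp-↭ L↭M w∈)) ,
  (λ p → ∈-resp-↭ (↭-sym L↭M) (complete p))

-- The three statements form one induction on length: the diagonals making up `code n` have tails
-- only from codes of smaller length.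
code-enumerates : ∀ n → Enumerates (InZ n) (code n)
cellsₒ-enumerates : ∀ k m → Enumerates (Tail (suc (k + k)) (k + k + m)) (cellsₒ k m)
cellsₑ-enumerates : ∀ k m → Enumerates (Tail (2 + (k + k)) (suc (k + k + m))) (cellsₑ k m)

code-enumerates n with enumerates-↭ (code-↭ n) (cellsₒ-enumerates 0 n)
... | u , sound , complete = u , (λ w∈ → Tail⇒InZ (sound w∈)) , (λ p → complete (InZ⇒Tail p))

cellsₒ-enumerates k zero    rewrite +-identityʳ (k + k) = enumerates-base (k + k)
cellsₒ-enumerates k (suc m) = enumerates-step ≤-refl (n≤1+n _) (+-suc k k) (sym (+-suc (k + k) m))
  (code-enumerates m)
  (subst (λ n → Enumerates (Tail (2 + (k + k)) n) (cellsₑ k m)) (sym (+-suc (k + k) m)) (cellsₑ-enumerates k m))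

cellsₑ-enumerates k zero    rewrite +-identityʳ (k + k) = enumerates-base (suc (k + k))
cellsₑ-enumerates k (suc m) = enumerates-step (n≤1+n _) ≤-refl
  (trans (+-suc k (suc k)) (cong suc (+-suc k k))) (cong suc (sym (+-suc (k + k) m)))
  (code-enumerates m)
  (subst₂ (λ t n → Enumerates (Tail t n) (cellsₒ (suc k) m))
    (cong (2 +_) (+-suc k k))
    (cong suc (trans (cong (_+ m) (+-suc k k)) (sym (+-suc (k + k) m)))) (cellsₒ-enumerates (suc k) m))

-- Hamming distance and the periodic end words.

hamming-refl : ∀ w → hamming w w ≡ 0
hamming-refl []      = refl
hamming-refl (O ∷ w) = hamming-refl w
hamming-refl (I ∷ w) = hamming-refl w

Adj⇒hamming : ∀ {u v} → Adj u v → hamming u v ≤ 1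
Adj⇒hamming (flip O w) = ≤-reflexive (cong suc (hamming-refl w))
Adj⇒hamming (flip I w) = ≤-reflexive (cong suc (hamming-refl w))
Adj⇒hamming (keep O p) = Adj⇒hamming p
Adj⇒hamming (keep I p) = Adj⇒hamming p

path-consec : ∀ {x y L} → Path y x L → Consec1 L
path-consec end                   = [ _ ]
path-consec (step a end)          = Adj⇒hamming a ∷ [ _ ]
path-consec (step a p@(step _ _)) = Adj⇒hamming a ∷ path-consec p

path-last : ∀ {x y L} → Path y x L → Last L y
path-last end        = [] , refl
path-last (step {x} a p) with L′ , eq ← path-last p = x ∷ L′ , cong (x ∷_) eq

-- The function that star unfolds to is local to star, hence not nameable; unification finds it.
mutual
  repeat : ℕ → Word → ℕ → Word
  repeat = _

  star-suc : ∀ k v → star (suc k) v ≡ take (suc k) (v ++ repeat (suc k) v k)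
  -- Abstracting `suc k` leaves `repeat` applied to distinct variables, which determines it.
  star-suc k v with suc k
  ... | n = refl

-- Each copy supplies three letters, so `m` copies are more than enough. The outer length `n` stays
-- fixed during the induction.
take-repeat : ∀ n m k → m ≤ k → take m (repeat n (O ∷ O ∷ I ∷ []) k) ≡ s m
take-repeat n zero                k       _         = refl
take-repeat n (suc zero)          (suc k) _         = refl
take-repeat n (suc (suc zero))    (suc k) _         = refl
take-repeat n (suc (suc (suc m))) (suc k) (s≤s m+2≤k) =
  cong (λ w → O ∷ O ∷ I ∷ w) (take-repeat n m k (≤-trans (m≤n+m m 2) m+2≤k))

star≡s : ∀ n → star n (O ∷ O ∷ I ∷ []) ≡ s n
star≡s zero    = refl
star≡s (suc n) = take-repeat (suc n) (suc n) (suc n) ≤-refl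

-- Needed for the first word: trimming 0 `s n` to length `n` shortens `s n` by one letter.
take-s : ∀ m → take m (s (suc m)) ≡ s m
take-s zero                = refl
take-s (suc zero)          = refl
take-s (suc (suc zero))    = refl
take-s (suc (suc (suc m))) = cong (λ w → O ∷ O ∷ I ∷ w) (take-s m)

take-O∷s : ∀ n → take n (O ∷ s n) ≡ f n
take-O∷s zero    = refl
take-O∷s (suc n) = cong (O ∷_) (take-s n)

theorem3 : (n : ℕ) → ∃ λ (L : List Word) →
    IsGrayCode1 (InZ n) L
    × First L (take n (false ∷ star n (false ∷ false ∷ true ∷ [])))
    × Last L (star n (false ∷ false ∷ true ∷ []))
theorem3 n rewrite star≡s n | take-O∷s n with code-enumerates n
... | unique , sound , complete =
  code n , (unique , tabulate sound , (λ _ → complete) , path-consec (path-code n)) ,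
  (_ , path-head (path-code n)) , path-last (path-code n)
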